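{- Let $w_1,w_2,w_3$ be any odd positive integers. Then for every integer $n\ge 0$ and every $y_1\in\mathbb{Z}_p$, the following three expressions are equal: \begin{align*} &(w_1w_2)^n\sum_{a=0}^{w_1d-1}\sum_{b=0}^{w_2d-1}(-1)^{a+b}\chi(ab)E_{n,\chi}\Big(w_3y_1+\frac{w_3}{w_1}a+\frac{w_3}{w_2}b\Big)\\ =&(w_2w_3)^n\sum_{a=0}^{w_2d-1}\sum_{b=0}^{w_3d-1}(-1)^{a+b}\chi(ab)E_{n,\chi}\Big(w_1y_1+\frac{w_1}{w_2}a+\frac{w_1}{w_3}b\Big)\\ =&(w_3w_1)^n\sum_{a=0}^{w_3d-1}\sum_{b=0}^{w_1d-1}(-1)^{a+b}\chi(ab)E_{n,\chi}\Big(w_2y_1+\frac{w_2}{w_3}a+\frac{w_2}{w_1}b\Big). \end{align*}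
   Context: $p$ is a fixed odd prime, $\mathbb{Z}_p$ is the ring of $p$-adic integers, and $\mathbb{C}_p$ is the completion of an algebraic closure of $\mathbb{Q}_p$. $d$ is a fixed odd positive integer and $\chi$ is a (primitive) Dirichlet character of conductor $d$, with values in $\overline{\mathbb{Q}}$, regarded as $\mathbb{C}_p$-valued through a fixed embedding $\overline{\mathbb{Q}}\to\mathbb{C}_p$; as usual $\chi(a)=0$ when $\gcd(a,d)>1$ (and $\chi\equiv 1$ if $d=1$). The generalized Euler polynomials $E_{n,\chi}(x)$ attached to $\chi$ are the polynomials in $x$ (with coefficients in $\mathbb{C}_p$, so they can be evaluated at any element of $\mathbb{C}_p$) defined by $$\frac{2e^{xt}}{e^{dt}+1}\sum_{a=0}^{d-1}(-1)^a\chi(a)e^{at}=\sum_{n=0}^{\infty}E_{n,\chi}(x)\frac{t^n}{n!}.$$ -}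

module Defs where

open import Level using (Level; _⊔_) renaming (suc to lsuc)
open import Algebra.Bundles using (CommutativeRing)
open import Algebra.Apartness.Bundles using (HeytingField; HeytingCommutativeRing)
open import Algebra.Morphism.Structures using (IsRingHomomorphism)
open import Data.Fin.Base using (Fin; toℕ)
open import Data.Integer.Base as ℤ using (ℤ; +_)
open import Data.Integer.Coprimality using (Coprime)
import Data.Integer.Divisibility as ℤDiv
open import Data.Nat.Base as ℕ using (ℕ; zero; suc; NonZero; _!)
import Data.Nat.Divisibility as ℕDiv
open import Data.Nat.Properties using (_!≢0)
open import Data.Product.Base using (_×_; ∃-syntax; _,_)
open import Data.Rational.Base as ℚ using (ℚ; 1ℚ; ½)
open import Data.Vec.Functional using (Vector; []; _∷_)
open import Relation.Binary.PropositionalEquality.Core using (_≡_)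
open import Relation.Nullary.Negation using (¬_)
import Algebra.Properties.Semiring.Exp as SemiringExp
import Algebra.Properties.Semiring.Sum as SemiringSum
import Relation.Binary.Reasoning.Setoid as SetoidReasoning

Odd : ℕ → Set
Odd n = ¬ (2 ℕDiv.∣ n)

------------------------------------------------------------------------
-- Formal power series, as coefficient sequences

module PowerSeries {c ℓ} (R : CommutativeRing c ℓ) where
  open CommutativeRing R
  open SemiringSum semiring

  Series : Set c
  Series = ℕ → Carrier

  infix  4 _≋_
  infixl 6 _⊕_
  infixl 7 _⊛_
  infixr 8 _·_

  _≋_ : Series → Series → Set ℓ
  f ≋ g = ∀ n → f n ≈ g n

  one : Series
  one zero    = 1#
  one (suc _) = 0#

  _⊕_ : Series → Series → Series
  (f ⊕ g) n = f n + g n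

  _·_ : Carrier → Series → Series
  (k · f) n = k * f n

  _⊛_ : Series → Series → Series
  (f ⊛ g) n = ∑[ i ≤ n ] (f (toℕ i) * g (n ℕ.∸ toℕ i))

  -- The inverse of a series f with f 0 * u ≈ 1#, solving f ⊛ g ≋ one for
  -- g one coefficient at a time.  The vector handed to `step f u n` holds
  -- the coefficients already found, latest first: g (n - 1), …, g 0.
  private
    step : Series → Carrier → (n : ℕ) → Vector Carrier n → Carrier
    step f u zero    gs = u
    step f u (suc n) gs = - (u * ∑[ i < suc n ] (f (suc (toℕ i)) * gs i))

    found : Series → Carrier → (n : ℕ) → Vector Carrier n
    found f u zero    = []
    found f u (suc n) = step f u n (found f u n) ∷ found f u n

  inverse : (f : Series) (u : Carrier) → f 0 * u ≈ 1# → Series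
  inverse f u _ n = step f u n (found f u n)

  ⊛-inverse : ∀ f u (f₀u≈1 : f 0 * u ≈ 1#) → f ⊛ inverse f u f₀u≈1 ≋ one
  ⊛-inverse f u f₀u≈1 zero = trans (+-identityʳ _) f₀u≈1
  ⊛-inverse f u f₀u≈1 (suc n) = begin
      f 0 * - (u * S) + T    ≈⟨ +-cong f₀g≈-S (sum-cong-≋ T≈S) ⟩
      - S + S                ≈⟨ -‿inverseˡ S ⟩
      0#                     ∎
    where
    open SetoidReasoning setoid
    open import Algebra.Properties.Ring ring using (-‿distribʳ-*)
    g = inverse f u f₀u≈1
    S = ∑[ i < suc n ] (f (suc (toℕ i)) * found f u (suc n) i)
    T = ∑[ i < suc n ] (f (suc (toℕ i)) * g (n ℕ.∸ toℕ i))

    f₀g≈-S : f 0 * - (u * S) ≈ - S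
    f₀g≈-S = begin
      f 0 * - (u * S)    ≈⟨ -‿distribʳ-* (f 0) (u * S) ⟨
      - (f 0 * (u * S))  ≈⟨ -‿cong (*-assoc (f 0) u S) ⟨
      - (f 0 * u * S)    ≈⟨ -‿cong (*-congʳ f₀u≈1) ⟩
      - (1# * S)         ≈⟨ -‿cong (*-identityˡ S) ⟩
      - S                ∎

    found-correct : ∀ m (i : Fin (suc m)) → g (m ℕ.∸ toℕ i) ≈ found f u (suc m) i
    found-correct m       Fin.zero    = refl
    found-correct (suc m) (Fin.suc i) = found-correct m i

    T≈S : ∀ i → f (suc (toℕ i)) * g (n ℕ.∸ toℕ i) ≈ f (suc (toℕ i)) * found f u (suc n) i
    T≈S i = *-congˡ (found-correct n i)

------------------------------------------------------------------------
-- Fields of characteristic zero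

record FieldOverℚ c ℓ₁ ℓ₂ : Set (lsuc (c ⊔ ℓ₁ ⊔ ℓ₂)) where
  field
    heytingField : HeytingField c ℓ₁ ℓ₂

  open HeytingField heytingField public using (heytingCommutativeRing; _#_)
  open HeytingCommutativeRing heytingCommutativeRing public using (commutativeRing)
  open CommutativeRing commutativeRing public hiding (_≉_)

  field
    fromℚ              : ℚ → Carrier
    isRingHomomorphism : IsRingHomomorphism ℚ.+-*-rawRing rawRing fromℚ

  open SemiringExp semiring public using (_^_)
  open SemiringSum semiring public using (sum; sum-syntax)

  fromℤ : ℤ → Carrier
  fromℤ m = fromℚ (m ℚ./ 1)

  fromℕ : ℕ → Carrier
  fromℕ n = fromℤ (+ n)

  -- The value at x of the monic polynomial Xⁿ + ∑ᵢ cᵢ Xⁱ.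
  monic : ∀ {n} → Vector Carrier n → Carrier → Carrier
  monic {n} c x = x ^ n + ∑[ i < n ] (c i * x ^ toℕ i)

  -- For F a subfield, this says that x is algebraic over F.
  AlgebraicOver : ∀ {ℓ} → (Carrier → Set ℓ) → Carrier → Set (c ⊔ ℓ₁ ⊔ ℓ)
  AlgebraicOver F x =
    ∃[ n ] ∃[ c ] (∀ (i : Fin n) → F (c i)) × monic c x ≈ 0#

  -- For F a subfield, this says that F is algebraically closed.
  AlgebraicallyClosed : ∀ {ℓ} → (Carrier → Set ℓ) → Set (c ⊔ ℓ₁ ⊔ ℓ)
  AlgebraicallyClosed F =
    ∀ n (c : Vector Carrier (suc n)) → (∀ i → F (c i)) → ∃[ x ] F x × monic c x ≈ 0#

record AlgebraicClosureOfℚ c ℓ₁ ℓ₂ : Set (lsuc (c ⊔ ℓ₁ ⊔ ℓ₂)) where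
  field
    fieldOverℚ : FieldOverℚ c ℓ₁ ℓ₂

  open FieldOverℚ fieldOverℚ public

  field
    algebraic : ∀ x → AlgebraicOver (λ y → ∃[ q ] y ≈ fromℚ q) x
    closed    : ∀ n (c : Vector Carrier (suc n)) → ∃[ x ] monic c x ≈ 0#

------------------------------------------------------------------------
-- ℂ_p is not constructed but characterised: a field that is complete for a
-- valuation with v(p) = 1, in which the algebraic closure of ℚ_p is
-- algebraically closed and dense.  Classically this determines it up to
-- isomorphism of valued fields.  The absolute value is |x| = p^(- v x).

record CompletedAlgebraicClosureOfℚₚ (p : ℕ) c ℓ₁ ℓ₂ : Set (lsuc (c ⊔ ℓ₁ ⊔ ℓ₂)) where
  field
    fieldOverℚ : FieldOverℚ c ℓ₁ ℓ₂

  open FieldOverℚ fieldOverℚ public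

  -- As v is ultrametric, v p = 1 already forces v to restrict to the p-adic
  -- valuation on ℚ.  The value group of ℂ_p is ℚ.
  field
    v      : ∀ x → x # 0# → ℚ
    v-cong : ∀ {x y} → x ≈ y → ∀ hx hy → v x hx ≡ v y hy
    v-*    : ∀ x y hx hy hxy → v (x * y) hxy ≡ v x hx ℚ.+ v y hy
    v-+    : ∀ x y hx hy hxy → v x hx ℚ.⊓ v y hy ℚ.≤ v (x + y) hxy
    v-p    : ∀ h → v (fromℕ p) h ≡ 1ℚ

  -- |x - y| ≤ p^(- k); for x ≈ y the condition is void.
  Close : ℕ → Carrier → Carrier → Set ℓ₂
  Close k x y = ∀ (h : (x - y) # 0#) → (+ k ℚ./ 1) ℚ.≤ v (x - y) h

  Cauchy : (ℕ → Carrier) → Set ℓ₂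
  Cauchy s = ∀ k → ∃[ N ] (∀ m n → N ℕ.≤ m → N ℕ.≤ n → Close k (s m) (s n))

  _ConvergesTo_ : (ℕ → Carrier) → Carrier → Set ℓ₂
  s ConvergesTo x = ∀ k → ∃[ N ] (∀ n → N ℕ.≤ n → Close k (s n) x)

  -- ℤ_p and ℚ_p are the closures of ℤ and of ℚ.
  _∈ℤₚ : Carrier → Set ℓ₂
  x ∈ℤₚ = ∀ k → ∃[ m ] Close k x (fromℤ m)

  _∈ℚₚ : Carrier → Set ℓ₂
  x ∈ℚₚ = ∀ k → ∃[ q ] Close k x (fromℚ q)

  field
    complete : ∀ s → Cauchy s → ∃[ x ] s ConvergesTo x
    closed   : AlgebraicallyClosed (AlgebraicOver _∈ℚₚ)
    dense    : ∀ x k → ∃[ y ] AlgebraicOver _∈ℚₚ y × Close k x y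

------------------------------------------------------------------------
-- Dirichlet characters

record DirichletCharacter {c ℓ} (R : CommutativeRing c ℓ) (d : ℕ) : Set (c ⊔ ℓ) where
  open CommutativeRing R using (Carrier; _≈_; _*_; 0#; 1#)
  field
    χ        : ℤ → Carrier
    periodic : ∀ a b → (+ d) ℤDiv.∣ (a ℤ.- b) → χ a ≈ χ b
    χ-*      : ∀ a b → χ (a ℤ.* b) ≈ χ a * χ b
    χ-1      : χ (+ 1) ≈ 1#
    χ-0      : ∀ a → ¬ Coprime a (+ d) → χ a ≈ 0#

  FactorsThrough : ℕ → Set ℓ
  FactorsThrough e =
    ∀ a b → Coprime a (+ d) → Coprime b (+ d) → (+ e) ℤDiv.∣ (a ℤ.- b) → χ a ≈ χ b

  -- The conductor of χ is its modulus d.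
  Primitive : Set ℓ
  Primitive = ∀ e → e ℕDiv.∣ d → e ℕ.< d → ¬ FactorsThrough e

------------------------------------------------------------------------
-- Generalized Euler polynomials

module Euler {c ℓ₁ ℓ₂} (K : FieldOverℚ c ℓ₁ ℓ₂) (d : ℕ)
             (χ : ℤ → FieldOverℚ.Carrier K) where
  open FieldOverℚ K
  open PowerSeries commutativeRing

  sign : ℕ → Carrier
  sign n = (- 1#) ^ n

  -- e^{xt}
  exp : Carrier → Series
  exp x n = fromℚ ((+ 1 ℚ./ n !) {{n !≢0}}) * x ^ n

  -- ∑_{0 ≤ a < d} (-1)^a χ(a) e^{at}
  characterSum : Series
  characterSum n = ∑[ a < d ] (sign (toℕ a) * χ (+ toℕ a) * exp (fromℕ (toℕ a)) n)

  -- e^{dt} + 1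
  denominator : Series
  denominator = exp (fromℕ d) ⊕ one

  denominator₀ : denominator 0 * fromℚ ½ ≈ 1#
  denominator₀ = begin
    (fromℚ 1ℚ * 1# + 1#) * fromℚ ½        ≈⟨ *-congʳ (+-cong (*-identityʳ _) (sym 1#-homo)) ⟩
    (fromℚ 1ℚ + fromℚ 1ℚ) * fromℚ ½       ≈⟨ *-congʳ (+-homo 1ℚ 1ℚ) ⟨
    fromℚ (1ℚ ℚ.+ 1ℚ) * fromℚ ½           ≈⟨ *-homo (1ℚ ℚ.+ 1ℚ) ½ ⟨
    fromℚ ((1ℚ ℚ.+ 1ℚ) ℚ.* ½)             ≈⟨ 1#-homo ⟩
    1#                                    ∎
    where
    open SetoidReasoning setoid
    open IsRingHomomorphism isRingHomomorphism using (+-homo; *-homo; 1#-homo)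

  generatingFunction : Carrier → Series
  generatingFunction x =
    (fromℕ 2 · exp x) ⊛ inverse denominator (fromℚ ½) denominator₀ ⊛ characterSum

  -- E_{n,χ}(x), i.e. n! times the coefficient of tⁿ.  The defining identity
  -- is read with x specialised to an element of K.
  E : ℕ → Carrier → Carrier
  E n x = fromℕ (n !) * generatingFunction x n

  ratio : ℕ → (w : ℕ) .{{_ : NonZero w}} → Carrier
  ratio m w = fromℚ (+ m ℚ./ w)

  -- The second and third expressions arise from the first by cyclically
  -- permuting the weights.
  doubleSum : (u v w : ℕ) .{{_ : NonZero u}} .{{_ : NonZero v}} → ℕ → Carrier → Carrier
  doubleSum u v w n y =
    fromℕ ((u ℕ.* v) ℕ.^ n) *
    (∑[ a < u ℕ.* d ] ∑[ b < v ℕ.* d ]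
      (sign (toℕ a ℕ.+ toℕ b) * χ (+ (toℕ a ℕ.* toℕ b)) *
       E n (fromℕ w * y + ratio w u * fromℕ (toℕ a) + ratio w v * fromℕ (toℕ b))))

{-# OPTIONS --safe #-}
module Submission where

-- Put Q(k) = C(kt) / (e^{kdt} + 1), where C(t) = ∑_{0 ≤ a < d} (-1)^a χ(a) e^{at}.
-- For odd m, splitting a < md into blocks of length d gives a geometric series:
--   ∑_{0 ≤ a < md} (-1)^a χ(a) e^{kat} = Q(k) (e^{mkdt} + 1).
-- The factor (uv)^n replaces t by uvt in the generating function of E_{n,χ},
-- so the double sum with weights u, v, w is n! times the coefficient of t^n in
--   2 e^{uvwyt} (e^{uvwdt} + 1)² Q(uv) Q(vw) Q(wu),
-- which is symmetric in u, v, w.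

open import Defs
open import Algebra.Bundles using (CommutativeRing)
open import Algebra.Morphism.Structures using (IsRingHomomorphism; IsRingMonomorphism)
import Algebra.Properties.CommutativeSemiring.Binomial as Binomial
import Algebra.Properties.CommutativeSemiring.Exp as CommutativeExp
import Algebra.Properties.Ring as RingProperties
import Algebra.Properties.Semiring.Exp as Exp
import Algebra.Properties.Semiring.Mult as Mult
import Algebra.Properties.Semiring.Sum as Sum
import Algebra.Solver.CommutativeMonoid as CommutativeMonoidSolver
open import Data.Fin.Base using (Fin; toℕ)
open import Data.Fin.Properties using (toℕ≤pred[n])
open import Data.Integer.Base as ℤ using (ℤ; +_)
import Data.Integer.Divisibility as ℤDiv
import Data.Integer.Properties as ℤ
open import Data.Nat.Base as ℕ using (ℕ; zero; suc; NonZero; _!)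
open import Data.Nat.Combinatorics using (_C_; nCk≡n!/k![n-k]!; k![n∸k]!∣n!)
import Data.Nat.Divisibility as ℕDiv
open import Data.Nat.DivMod using (m/n*n≡m)
open import Data.Nat.Primality using (Prime)
import Data.Nat.Properties as ℕ
open import Data.Nat.Solver using (module +-*-Solver)
open import Data.Product.Base using (_×_; _,_; ∃-syntax)
open import Data.Rational.Base as ℚ using (½)
import Data.Rational.Properties as ℚ
open import Data.Rational.Unnormalised.Base as ℚᵘ using (mkℚᵘ; *≡*)
import Data.Rational.Unnormalised.Properties as ℚᵘ
open import Data.Vec.Functional using (Vector)
open import Function.Base using (_∘_)
import Relation.Binary.Reasoning.Setoid as SetoidReasoning
open import Relation.Binary.PropositionalEquality as ≡ using (_≡_)
open import Relation.Nullary.Negation using (contradiction)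

-- Two parities drive the argument. Moving to the next block multiplies a term by (-1)^d e^{kdt},
-- which is - e^{kdt} because d is odd; the numerator 1 - (- e^{kdt})^m is then 1 + e^{mkdt} because
-- m is odd. The scaling by uv makes the two sums fit together: it turns w/u and w/v into the
-- integers vw and uw, so the sum over a < ud runs at level k = vw and the sum over b < vd at level
-- k = uw. Both numerators therefore carry the same exponent uvwd. Since χ(ab) = χ(a)χ(b) and
-- (-1)^{a+b} splits likewise, the double sum is a product of these two single sums; the remaining
-- quotient Q(uv) comes from the generating function itself. Everything takes place in K[[t]], where
-- e^{kdt} + 1 is a unit because its constant term is 2.

-- Parity and binomial coefficients

odd⇒suc[2*k] : ∀ m → Odd m → ∃[ k ] m ≡ suc (2 ℕ.* k)
odd⇒suc[2*k] zero          odd = contradiction (2 ℕDiv.∣0) odd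
odd⇒suc[2*k] (suc zero)    odd = 0 , ≡.refl
odd⇒suc[2*k] (suc (suc m)) odd
  with odd⇒suc[2*k] m (odd ∘ ℕDiv.∣m∣n⇒∣m+n ℕDiv.∣-refl)
... | k , ≡.refl = suc k , ≡.cong (suc ∘ suc) (≡.sym (ℕ.+-suc k (k ℕ.+ 0)))

nCk*k![n∸k]!≡n! : ∀ {n k} → k ℕ.≤ n → (n C k) ℕ.* (k ! ℕ.* (n ℕ.∸ k) !) ≡ n !
nCk*k![n∸k]!≡n! {n} {k} k≤n = ≡.trans
  (≡.cong (ℕ._* (k ! ℕ.* (n ℕ.∸ k) !)) (nCk≡n!/k![n-k]! k≤n))
  (m/n*n≡m {{k ℕ.!* (n ℕ.∸ k) !≢0}} (k![n∸k]!∣n! k≤n))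

-- Rational numbers

-- `ℚ./` divides by a gcd and does not compute on variables. As `fromℚᵘ` of a `mkℚᵘ` unfolds to such
-- a quotient, identities between quotients can be transported from unnormalised rationals, where
-- equality is cross-multiplication.
fromℚᵘ-homo-+ : ∀ p q → ℚ.fromℚᵘ (p ℚᵘ.+ q) ≡ ℚ.fromℚᵘ p ℚ.+ ℚ.fromℚᵘ q
fromℚᵘ-homo-+ p q = ℚ.toℚᵘ-injective (begin
  ℚ.toℚᵘ (ℚ.fromℚᵘ (p ℚᵘ.+ q))                     ≈⟨ ℚ.toℚᵘ-fromℚᵘ _ ⟩
  p ℚᵘ.+ q                                         ≈⟨ ℚᵘ.+-cong (ℚ.toℚᵘ-fromℚᵘ p) (ℚ.toℚᵘ-fromℚᵘ q) ⟨
  ℚ.toℚᵘ (ℚ.fromℚᵘ p) ℚᵘ.+ ℚ.toℚᵘ (ℚ.fromℚᵘ q)     ≈⟨ ℚ.toℚᵘ-homo-+ (ℚ.fromℚᵘ p) (ℚ.fromℚᵘ q) ⟨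
  ℚ.toℚᵘ (ℚ.fromℚᵘ p ℚ.+ ℚ.fromℚᵘ q)               ∎)
  where open SetoidReasoning ℚᵘ.≃-setoid

fromℚᵘ-homo-* : ∀ p q → ℚ.fromℚᵘ (p ℚᵘ.* q) ≡ ℚ.fromℚᵘ p ℚ.* ℚ.fromℚᵘ q
fromℚᵘ-homo-* p q = ℚ.toℚᵘ-injective (begin
  ℚ.toℚᵘ (ℚ.fromℚᵘ (p ℚᵘ.* q))                     ≈⟨ ℚ.toℚᵘ-fromℚᵘ _ ⟩
  p ℚᵘ.* q                                         ≈⟨ ℚᵘ.*-cong (ℚ.toℚᵘ-fromℚᵘ p) (ℚ.toℚᵘ-fromℚᵘ q) ⟨
  ℚ.toℚᵘ (ℚ.fromℚᵘ p) ℚᵘ.* ℚ.toℚᵘ (ℚ.fromℚᵘ q)     ≈⟨ ℚ.toℚᵘ-homo-* (ℚ.fromℚᵘ p) (ℚ.fromℚᵘ q) ⟨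
  ℚ.toℚᵘ (ℚ.fromℚᵘ p ℚ.* ℚ.fromℚᵘ q)               ∎)
  where open SetoidReasoning ℚᵘ.≃-setoid

n/1-homo-+ : ∀ m n → (+ (m ℕ.+ n)) ℚ./ 1 ≡ (+ m ℚ./ 1) ℚ.+ (+ n ℚ./ 1)
n/1-homo-+ m n = ≡.trans
  (ℚ.fromℚᵘ-cong {mkℚᵘ (+ (m ℕ.+ n)) 0} {mkℚᵘ (+ m) 0 ℚᵘ.+ mkℚᵘ (+ n) 0}
    (*≡* (≡.cong (ℤ._* + 1) (≡.sym (≡.cong₂ ℤ._+_ (ℤ.*-identityʳ (+ m)) (ℤ.*-identityʳ (+ n)))))))
  (fromℚᵘ-homo-+ (mkℚᵘ (+ m) 0) (mkℚᵘ (+ n) 0))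

n/1-homo-* : ∀ m n → (+ (m ℕ.* n)) ℚ./ 1 ≡ (+ m ℚ./ 1) ℚ.* (+ n ℚ./ 1)
n/1-homo-* m n = ≡.trans
  (ℚ.fromℚᵘ-cong {mkℚᵘ (+ (m ℕ.* n)) 0} {mkℚᵘ (+ m) 0 ℚᵘ.* mkℚᵘ (+ n) 0}
    (*≡* (≡.cong (ℤ._* + 1) (ℤ.pos-* m n))))
  (fromℚᵘ-homo-* (mkℚᵘ (+ m) 0) (mkℚᵘ (+ n) 0))

m/n*n/1≡m/1 : ∀ m n .{{_ : NonZero n}} → (+ m ℚ./ n) ℚ.* (+ n ℚ./ 1) ≡ + m ℚ./ 1
-- `mkℚᵘ` stores the denominator minus one, so `mkℚᵘ (+ m) n` is m / (n + 1).
m/n*n/1≡m/1 m (suc n) = ≡.trans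
  (≡.sym (fromℚᵘ-homo-* (mkℚᵘ (+ m) n) (mkℚᵘ (+ suc n) 0)))
  (ℚ.fromℚᵘ-cong {mkℚᵘ (+ m) n ℚᵘ.* mkℚᵘ (+ suc n) 0} {mkℚᵘ (+ m) 0}
    (*≡* (≡.trans (ℤ.*-identityʳ _)
      (≡.cong (λ k → + m ℤ.* (+ k)) (≡.sym (ℕ.*-identityʳ (suc n)))))))

-- Identities in commutative rings

module RingIdentities {c ℓ} (R : CommutativeRing c ℓ) where
  open CommutativeRing R
  open Exp semiring
  open Sum semiring
  open RingProperties ring
  open SetoidReasoning setoid

  -x*-y≈x*y : ∀ x y → - x * - y ≈ x * y
  -x*-y≈x*y x y = begin
    - x * - y     ≈⟨ -‿distribˡ-* x (- y) ⟨
    - (x * - y)   ≈⟨ -‿cong (-‿distribʳ-* x y) ⟨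
    - - (x * y)   ≈⟨ -‿involutive (x * y) ⟩
    x * y         ∎

  [-x]^odd≈-x^odd : ∀ x m → Odd m → (- x) ^ m ≈ - (x ^ m)
  [-x]^odd≈-x^odd x m odd with odd⇒suc[2*k] m odd
  ... | k , ≡.refl = begin
    - x * (- x) ^ (2 ℕ.* k)  ≈⟨ *-congˡ (even k) ⟩
    - x * x ^ (2 ℕ.* k)      ≈⟨ -‿distribˡ-* _ _ ⟨
    - (x * x ^ (2 ℕ.* k))    ∎
    where
    even : ∀ k → (- x) ^ (2 ℕ.* k) ≈ x ^ (2 ℕ.* k)
    even k = begin
      (- x) ^ (2 ℕ.* k)      ≈⟨ ^-assocʳ (- x) 2 k ⟨
      ((- x) ^ 2) ^ k        ≈⟨ ^-congˡ k (trans (*-congˡ (*-identityʳ _)) (trans (-x*-y≈x*y x x) (*-congˡ (sym (*-identityʳ _))))) ⟩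
      (x ^ 2) ^ k            ≈⟨ ^-assocʳ x 2 k ⟩
      x ^ (2 ℕ.* k)          ∎

  -- Summands are functions on ℕ rather than on `Fin`, so that the second block is a plain shift of
  -- the argument.
  sum-splitAt : ∀ m n (f : ℕ → Carrier) →
    ∑[ i < m ℕ.+ n ] f (toℕ i) ≈ ∑[ i < m ] f (toℕ i) + ∑[ i < n ] f (m ℕ.+ toℕ i)
  sum-splitAt zero    n f = sym (+-identityˡ _)
  sum-splitAt (suc m) n f = trans (+-congˡ (sum-splitAt m n (f ∘ suc))) (sym (+-assoc _ _ _))

  ∑∑-*ˡ : ∀ {m n} x (f : Fin m → Fin n → Carrier) →
    x * (∑[ i < m ] ∑[ j < n ] f i j) ≈ ∑[ i < m ] ∑[ j < n ] (x * f i j)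
  ∑∑-*ˡ {m} {n} x f = trans (*-distribˡ-sum {m} x (λ i → ∑[ j < n ] f i j))
    (sum-cong-≋ {m} (λ i → *-distribˡ-sum {n} x (f i)))

  ∑∑-product : ∀ {m n} x (f : Fin m → Carrier) (g : Fin n → Carrier) →
    ∑[ i < m ] ∑[ j < n ] (x * f i * g j) ≈ x * sum f * sum g
  ∑∑-product {m} {n} x f g = begin
    ∑[ i < m ] ∑[ j < n ] (x * f i * g j)   ≈⟨ sum-cong-≋ {m} (λ i → *-distribˡ-sum {n} (x * f i) g) ⟨
    ∑[ i < m ] (x * f i * sum g)            ≈⟨ *-distribʳ-sum {m} (sum g) (λ i → x * f i) ⟨
    ∑[ i < m ] (x * f i) * sum g            ≈⟨ *-congʳ (*-distribˡ-sum {m} x f) ⟨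
    x * sum f * sum g                       ∎

  module _ (e C : Carrier) (B : ℕ → Carrier) (B₀ : B 0 ≈ 0#)
           (B₊ : ∀ m → B (suc m) ≈ C + - e * B m) where

    -- The hypotheses force `B m` to be C (1 + (- e) + ... + (- e)^(m-1)), in Horner form: a new
    -- block is put in front and the old ones are multiplied by - e. This is the geometric sum
    -- formula with the subtracted term moved to the left.
    alternatingSum : ∀ m → (e + 1#) * B m + (- e) ^ m * C ≈ C
    alternatingSum zero = begin
      (e + 1#) * B 0 + 1# * C    ≈⟨ +-cong (trans (*-congˡ B₀) (zeroʳ _)) (*-identityˡ C) ⟩
      0# + C                     ≈⟨ +-identityˡ C ⟩
      C                          ∎
    alternatingSum (suc m) = begin
      (e + 1#) * B (suc m) + - e * (- e) ^ m * C                         ≈⟨ +-cong (*-congˡ (B₊ m)) (*-assoc _ _ _) ⟩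
      (e + 1#) * (C + - e * B m) + - e * ((- e) ^ m * C)                 ≈⟨ +-congʳ (distribˡ _ _ _) ⟩
      (e + 1#) * C + (e + 1#) * (- e * B m) + - e * ((- e) ^ m * C)      ≈⟨ +-assoc _ _ _ ⟩
      (e + 1#) * C + ((e + 1#) * (- e * B m) + - e * ((- e) ^ m * C))    ≈⟨ +-congˡ (+-congʳ swap) ⟩
      (e + 1#) * C + (- e * ((e + 1#) * B m) + - e * ((- e) ^ m * C))    ≈⟨ +-congˡ (distribˡ _ _ _) ⟨
      (e + 1#) * C + - e * ((e + 1#) * B m + (- e) ^ m * C)              ≈⟨ +-congˡ (*-congˡ (alternatingSum m)) ⟩
      (e + 1#) * C + - e * C                                             ≈⟨ distribʳ _ _ _ ⟨
      (e + 1# + - e) * C                                                 ≈⟨ *-congʳ (+-congʳ (+-comm e 1#)) ⟩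
      (1# + e + - e) * C                                                 ≈⟨ *-congʳ (+-assoc _ _ _) ⟩
      (1# + (e + - e)) * C                                               ≈⟨ *-congʳ (+-congˡ (-‿inverseʳ e)) ⟩
      (1# + 0#) * C                                                      ≈⟨ *-congʳ (+-identityʳ 1#) ⟩
      1# * C                                                             ≈⟨ *-identityˡ C ⟩
      C                                                                  ∎
      where
      swap : (e + 1#) * (- e * B m) ≈ - e * ((e + 1#) * B m)
      swap = trans (sym (*-assoc _ _ _)) (trans (*-congʳ (*-comm _ _)) (*-assoc _ _ _))

    -- For odd m the term `(- e) ^ m * C` equals - (e^m C), so adding e^m C to both sides of
    -- `alternatingSum` leaves (e^m + 1) C on the right. The inverse `i` of e + 1 is passed in
    -- because the ring need not be a field.
    alternatingSum-odd : ∀ {i} → (e + 1#) * i ≈ 1# → ∀ m → Odd m → B m ≈ i * C * (e ^ m + 1#)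
    alternatingSum-odd {i} [e+1]i≈1 m odd = begin
      B m                                                   ≈⟨ *-identityˡ _ ⟨
      1# * B m                                              ≈⟨ *-congʳ (trans (*-comm i (e + 1#)) [e+1]i≈1) ⟨
      i * (e + 1#) * B m                                    ≈⟨ *-assoc _ _ _ ⟩
      i * ((e + 1#) * B m)                                  ≈⟨ *-congˡ [e+1]B≈[e^m+1]C ⟩
      i * ((e ^ m + 1#) * C)                                ≈⟨ *-congˡ (*-comm _ _) ⟩
      i * (C * (e ^ m + 1#))                                ≈⟨ *-assoc _ _ _ ⟨
      i * C * (e ^ m + 1#)                                  ∎
      where
      [e+1]B≈[e^m+1]C : (e + 1#) * B m ≈ (e ^ m + 1#) * C
      [e+1]B≈[e^m+1]C = begin
        (e + 1#) * B m                                      ≈⟨ +-identityʳ _ ⟨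
        (e + 1#) * B m + 0#                                 ≈⟨ +-congˡ (trans (*-congʳ (-‿inverseˡ (e ^ m))) (zeroˡ C)) ⟨
        (e + 1#) * B m + (- (e ^ m) + e ^ m) * C            ≈⟨ +-congˡ (distribʳ _ _ _) ⟩
        (e + 1#) * B m + (- (e ^ m) * C + e ^ m * C)        ≈⟨ +-assoc _ _ _ ⟨
        (e + 1#) * B m + - (e ^ m) * C + e ^ m * C          ≈⟨ +-congʳ (+-congˡ (*-congʳ ([-x]^odd≈-x^odd e m odd))) ⟨
        (e + 1#) * B m + (- e) ^ m * C + e ^ m * C          ≈⟨ +-congʳ (alternatingSum m) ⟩
        C + e ^ m * C                                       ≈⟨ +-comm _ _ ⟩
        e ^ m * C + C                                       ≈⟨ +-congˡ (*-identityˡ C) ⟨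
        e ^ m * C + 1# * C                                  ≈⟨ distribʳ _ _ _ ⟨
        (e ^ m + 1#) * C                                    ∎

-- The ring of formal power series

module SeriesRing {c ℓ} (R : CommutativeRing c ℓ) where
  open CommutativeRing R
  open PowerSeries R
  open Exp semiring
  open Sum semiring
  open SetoidReasoning setoid
  private module CM = CommutativeMonoidSolver +-commutativeMonoid

  tail : Series → Series
  tail f = f ∘ suc

  ⊛-cong : ∀ {f f′ g g′} → f ≋ f′ → g ≋ g′ → f ⊛ g ≋ f′ ⊛ g′
  ⊛-cong f≋f′ g≋g′ n = sum-cong-≋ {suc n} (λ i → *-cong (f≋f′ (toℕ i)) (g≋g′ (n ℕ.∸ toℕ i)))

  ⊛-congˡ : ∀ f {g g′} → g ≋ g′ → f ⊛ g ≋ f ⊛ g′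
  ⊛-congˡ f = ⊛-cong {f} {f} (λ _ → refl)

  ⊛-congʳ : ∀ {f f′} g → f ≋ f′ → f ⊛ g ≋ f′ ⊛ g
  ⊛-congʳ g f≋f′ = ⊛-cong {g = g} f≋f′ (λ _ → refl)

  ⊛-distribʳ : ∀ h f g → (f ⊕ g) ⊛ h ≋ f ⊛ h ⊕ g ⊛ h
  ⊛-distribʳ h f g n = trans
    (sum-cong-≋ {suc n} (λ i → distribʳ (h (n ℕ.∸ toℕ i)) (f (toℕ i)) (g (toℕ i))))
    (∑-distrib-+ {suc n} (λ i → f (toℕ i) * h (n ℕ.∸ toℕ i)) (λ i → g (toℕ i) * h (n ℕ.∸ toℕ i)))

  ⊛-·ˡ : ∀ k f g → (k · f) ⊛ g ≋ k · (f ⊛ g)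
  ⊛-·ˡ k f g n = trans
    (sum-cong-≋ {suc n} (λ i → *-assoc k (f (toℕ i)) (g (n ℕ.∸ toℕ i))))
    (sym (*-distribˡ-sum {suc n} k (λ i → f (toℕ i) * g (n ℕ.∸ toℕ i))))

  -- Definitionally, tail (f ⊛ g) is f 0 · tail g ⊕ tail f ⊛ g; this is the
  -- recursion from the other end.
  tail-⊛ : ∀ f g n → (f ⊛ g) (suc n) ≈ f (suc n) * g 0 + (f ⊛ tail g) n
  tail-⊛ f g zero = CM.solve 2 (λ x y → x CM.⊕ (y CM.⊕ CM.id) CM.⊜ y CM.⊕ (x CM.⊕ CM.id)) refl _ _
  tail-⊛ f g (suc n) = trans (+-congˡ (tail-⊛ (tail f) g n))
    (CM.solve 3 (λ x y z → x CM.⊕ (y CM.⊕ z) CM.⊜ y CM.⊕ (x CM.⊕ z)) refl _ _ _)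

  -- Induction on the degree: the left side is peeled at the first coefficient of `f` by definition,
  -- the right side at the last summand by `tail-⊛`, and both leave a product with `tail f`.
  ⊛-comm : ∀ f g → f ⊛ g ≋ g ⊛ f
  ⊛-comm f g zero    = +-congʳ (*-comm _ _)
  ⊛-comm f g (suc n) = begin
    f 0 * g (suc n) + (tail f ⊛ g) n   ≈⟨ +-cong (*-comm _ _) (⊛-comm (tail f) g n) ⟩
    g (suc n) * f 0 + (g ⊛ tail f) n   ≈⟨ tail-⊛ g f n ⟨
    (g ⊛ f) (suc n)                    ∎

  ⊛-·ʳ : ∀ k f g → f ⊛ (k · g) ≋ k · (f ⊛ g)
  ⊛-·ʳ k f g n = trans (⊛-comm f (k · g) n) (trans (⊛-·ˡ k g f n) (*-congˡ (⊛-comm g f n)))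

  -- Induction on the degree with `f` replaced by `tail f`; the tail of `f ⊛ g` unfolds to a scalar
  -- multiple plus a product, so distributivity and `⊛-·ˡ` suffice and no double sum is reindexed.
  ⊛-assoc : ∀ f g h → (f ⊛ g) ⊛ h ≋ f ⊛ (g ⊛ h)
  ⊛-assoc f g h zero = +-congʳ (begin
    (f 0 * g 0 + 0#) * h 0      ≈⟨ *-congʳ (+-identityʳ _) ⟩
    f 0 * g 0 * h 0             ≈⟨ *-assoc _ _ _ ⟩
    f 0 * (g 0 * h 0)           ≈⟨ *-congˡ (+-identityʳ _) ⟨
    f 0 * (g 0 * h 0 + 0#)      ∎)
  ⊛-assoc f g h (suc n) = begin
    (f ⊛ g) 0 * h (suc n) + ((f 0 · tail g ⊕ tail f ⊛ g) ⊛ h) n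
      ≈⟨ +-cong (trans (*-congʳ (+-identityʳ _)) (*-assoc _ _ _)) (⊛-distribʳ h (f 0 · tail g) (tail f ⊛ g) n) ⟩
    f 0 * (g 0 * h (suc n)) + (((f 0 · tail g) ⊛ h) n + ((tail f ⊛ g) ⊛ h) n)
      ≈⟨ +-congˡ (+-cong (⊛-·ˡ (f 0) (tail g) h n) (⊛-assoc (tail f) g h n)) ⟩
    f 0 * (g 0 * h (suc n)) + (f 0 * (tail g ⊛ h) n + (tail f ⊛ (g ⊛ h)) n)
      ≈⟨ +-assoc _ _ _ ⟨
    f 0 * (g 0 * h (suc n)) + f 0 * (tail g ⊛ h) n + (tail f ⊛ (g ⊛ h)) n
      ≈⟨ +-congʳ (distribˡ _ _ _) ⟨
    f 0 * (g ⊛ h) (suc n) + (tail f ⊛ (g ⊛ h)) n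
      ∎

  ⊛-identityˡ : ∀ f → one ⊛ f ≋ f
  ⊛-identityˡ f zero    = trans (+-identityʳ _) (*-identityˡ _)
  ⊛-identityˡ f (suc n) = begin
    1# * f (suc n) + (tail one ⊛ f) n   ≈⟨ +-cong (*-identityˡ _) (sum-cong-≋ {suc n} (λ i → zeroˡ (f (n ℕ.∸ toℕ i)))) ⟩
    f (suc n) + ∑[ i ≤ n ] 0#           ≈⟨ +-congˡ (sum-replicate-zero (suc n)) ⟩
    f (suc n) + 0#                      ≈⟨ +-identityʳ _ ⟩
    f (suc n)                           ∎

  -- Makes `RingIdentities` and the monoid solver available with series as elements; the ratio of
  -- the geometric sum will itself be a series.
  seriesRing : CommutativeRing c ℓ
  seriesRing = record
    { Carrier = Series
    ; _≈_ = _≋_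
    ; _+_ = _⊕_
    ; _*_ = _⊛_
    ; -_ = λ f n → - f n
    ; 0# = λ _ → 0#
    ; 1# = one
    ; isCommutativeRing = record
      { isRing = record
        { +-isAbelianGroup = record
          { isGroup = record
            { isMonoid = record
              { isSemigroup = record
                { isMagma = record
                  { isEquivalence = record
                    { refl  = λ _ → refl
                    ; sym   = λ p n → sym (p n)
                    ; trans = λ p q n → trans (p n) (q n)
                    }
                  ; ∙-cong = λ p q n → +-cong (p n) (q n)
                  }
                ; assoc = λ f g h n → +-assoc (f n) (g n) (h n)
                }
              ; identity = (λ f n → +-identityˡ (f n)) , (λ f n → +-identityʳ (f n))
              }
            ; inverse = (λ f n → -‿inverseˡ (f n)) , (λ f n → -‿inverseʳ (f n))
            ; ⁻¹-cong = λ p n → -‿cong (p n)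
            }
          ; comm = λ f g n → +-comm (f n) (g n)
          }
        ; *-cong = λ {f} {f′} {g} {g′} → ⊛-cong {f} {f′} {g} {g′}
        ; *-assoc = ⊛-assoc
        ; *-identity = ⊛-identityˡ , λ f n → trans (⊛-comm f one n) (⊛-identityˡ f n)
        ; distrib = (λ f g h n → trans (⊛-comm f (g ⊕ h) n)
                        (trans (⊛-distribʳ f g h n) (+-cong (⊛-comm g f n) (⊛-comm h f n))))
                  , ⊛-distribʳ
        }
      ; *-comm = ⊛-comm
      }
    }

  private module Σ = Sum (CommutativeRing.semiring seriesRing)

  sum-coefficient : ∀ {m} (F : Vector Series m) n → Σ.sum F n ≈ ∑[ i < m ] F i n
  sum-coefficient {zero}  F n = refl
  sum-coefficient {suc m} F n = +-congˡ (sum-coefficient (F ∘ Fin.suc) n)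

  -- f(t) ↦ f(kt)
  dilate : Carrier → Series → Series
  dilate k f n = k ^ n * f n

  dilate-cong : ∀ k {f g} → f ≋ g → dilate k f ≋ dilate k g
  dilate-cong k f≋g n = *-congˡ (f≋g n)

  dilate-one : ∀ k → dilate k one ≋ one
  dilate-one k zero    = *-identityˡ _
  dilate-one k (suc n) = zeroʳ _

  dilate-⊕ : ∀ k f g → dilate k (f ⊕ g) ≋ dilate k f ⊕ dilate k g
  dilate-⊕ k f g n = distribˡ _ _ _

  dilate-· : ∀ k x f → dilate k (x · f) ≋ x · dilate k f
  dilate-· k x f n = trans (sym (*-assoc _ _ _)) (trans (*-congʳ (*-comm _ _)) (*-assoc _ _ _))

  -- The two degrees in each summand of coefficient n add up to n, so k^n splits accordingly.
  dilate-⊛ : ∀ k f g → dilate k (f ⊛ g) ≋ dilate k f ⊛ dilate k g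
  dilate-⊛ k f g n = begin
    k ^ n * (f ⊛ g) n
      ≈⟨ *-distribˡ-sum {suc n} (k ^ n) (λ i → f (toℕ i) * g (n ℕ.∸ toℕ i)) ⟩
    ∑[ i ≤ n ] (k ^ n * (f (toℕ i) * g (n ℕ.∸ toℕ i)))
      ≈⟨ sum-cong-≋ {suc n} term ⟩
    (dilate k f ⊛ dilate k g) n
      ∎
    where
    module M = CommutativeMonoidSolver *-commutativeMonoid
    term : ∀ i → k ^ n * (f (toℕ i) * g (n ℕ.∸ toℕ i)) ≈
                 (k ^ toℕ i * f (toℕ i)) * (k ^ (n ℕ.∸ toℕ i) * g (n ℕ.∸ toℕ i))
    term i = begin
      k ^ n * (f j * g l)          ≡⟨ ≡.cong (λ m → k ^ m * (f j * g l)) (ℕ.m+[n∸m]≡n (toℕ≤pred[n] i)) ⟨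
      k ^ (j ℕ.+ l) * (f j * g l)  ≈⟨ *-congʳ (^-homo-* k j l) ⟩
      k ^ j * k ^ l * (f j * g l)
        ≈⟨ M.solve 4 (λ a b x y → (a M.⊕ b) M.⊕ (x M.⊕ y) M.⊜ (a M.⊕ x) M.⊕ (b M.⊕ y)) refl (k ^ j) (k ^ l) (f j) (g l) ⟩
      k ^ j * f j * (k ^ l * g l)  ∎
      where
      j = toℕ i
      l = n ℕ.∸ toℕ i

-- Numerals and fractions in a field over ℚ

module FieldProperties {c ℓ₁ ℓ₂} (K : FieldOverℚ c ℓ₁ ℓ₂) where
  open FieldOverℚ K
  open IsRingHomomorphism isRingHomomorphism
  open Mult semiring using () renaming (_×_ to _×′_)
  open SetoidReasoning setoid
  private
    module M = CommutativeMonoidSolver *-commutativeMonoid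

  fromℚ-≡ : ∀ {p q} → p ≡ q → fromℚ p ≈ fromℚ q
  fromℚ-≡ ≡.refl = refl

  fromℕ-+ : ∀ m n → fromℕ (m ℕ.+ n) ≈ fromℕ m + fromℕ n
  fromℕ-+ m n = trans (fromℚ-≡ (n/1-homo-+ m n)) (+-homo _ _)

  fromℕ-* : ∀ m n → fromℕ (m ℕ.* n) ≈ fromℕ m * fromℕ n
  fromℕ-* m n = trans (fromℚ-≡ (n/1-homo-* m n)) (*-homo _ _)

  fromℕ-^ : ∀ m n → fromℕ (m ℕ.^ n) ≈ fromℕ m ^ n
  fromℕ-^ m zero    = 1#-homo
  fromℕ-^ m (suc n) = trans (fromℕ-* m (m ℕ.^ n)) (*-congˡ (fromℕ-^ m n))

  fromℕ-≡ : ∀ {m n} → m ≡ n → fromℕ m ≈ fromℕ n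
  fromℕ-≡ ≡.refl = refl

  -- The binomial theorem used below has its coefficients as repeated addition; as embedded numerals
  -- they can cancel against factorials.
  n×x≈fromℕ[n]*x : ∀ n x → n ×′ x ≈ fromℕ n * x
  n×x≈fromℕ[n]*x zero    x = sym (trans (*-congʳ 0#-homo) (zeroˡ x))
  n×x≈fromℕ[n]*x (suc n) x = begin
    x + n ×′ x                      ≈⟨ +-cong (*-identityˡ x) (sym (n×x≈fromℕ[n]*x n x)) ⟨
    1# * x + fromℕ n * x            ≈⟨ distribʳ _ _ _ ⟨
    (1# + fromℕ n) * x              ≈⟨ *-congʳ (+-congʳ 1#-homo) ⟨
    (fromℕ 1 + fromℕ n) * x         ≈⟨ *-congʳ (fromℕ-+ 1 n) ⟨
    fromℕ (suc n) * x               ∎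

  [m/n]*n≈m : ∀ m n .{{_ : NonZero n}} → fromℚ (+ m ℚ./ n) * fromℕ n ≈ fromℕ m
  [m/n]*n≈m m n = trans (sym (*-homo _ _)) (fromℚ-≡ (m/n*n/1≡m/1 m n))

  -- Meant for a = i!, b = (n - i)!, c = n! and k the binomial coefficient: this is what turns the
  -- binomial theorem into `exp-+`.
  [1/a]*[1/b]≈k/c : ∀ a b c k .{{_ : NonZero a}} .{{_ : NonZero b}} .{{_ : NonZero c}} →
    k ℕ.* (a ℕ.* b) ≡ c →
    fromℚ (+ 1 ℚ./ a) * fromℚ (+ 1 ℚ./ b) ≈ fromℚ (+ 1 ℚ./ c) * fromℕ k
  [1/a]*[1/b]≈k/c a b c k kab≡c = begin
    a⁻¹ * b⁻¹                                          ≈⟨ *-identityˡ _ ⟨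
    1# * (a⁻¹ * b⁻¹)                                   ≈⟨ *-congʳ (inv c) ⟨
    c⁻¹ * fromℕ c * (a⁻¹ * b⁻¹)                        ≈⟨ *-congʳ (*-congˡ (fromℕ-≡ (≡.sym kab≡c))) ⟩
    c⁻¹ * fromℕ (k ℕ.* (a ℕ.* b)) * (a⁻¹ * b⁻¹)        ≈⟨ *-congʳ (*-congˡ (trans (fromℕ-* k _) (*-congˡ (fromℕ-* a b)))) ⟩
    c⁻¹ * (fromℕ k * (fromℕ a * fromℕ b)) * (a⁻¹ * b⁻¹)
      ≈⟨ M.solve 6 (λ c k a b x y → (c M.⊕ (k M.⊕ (a M.⊕ b))) M.⊕ (x M.⊕ y)
                              M.⊜ (c M.⊕ k) M.⊕ ((x M.⊕ a) M.⊕ (y M.⊕ b))) refl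
           c⁻¹ (fromℕ k) (fromℕ a) (fromℕ b) a⁻¹ b⁻¹ ⟩
    c⁻¹ * fromℕ k * (a⁻¹ * fromℕ a * (b⁻¹ * fromℕ b))  ≈⟨ *-congˡ (trans (*-cong (inv a) (inv b)) (*-identityˡ _)) ⟩
    c⁻¹ * fromℕ k * 1#                                 ≈⟨ *-identityʳ _ ⟩
    c⁻¹ * fromℕ k                                      ∎
    where
    a⁻¹ = fromℚ (+ 1 ℚ./ a)
    b⁻¹ = fromℚ (+ 1 ℚ./ b)
    c⁻¹ = fromℚ (+ 1 ℚ./ c)
    inv : ∀ m .{{_ : NonZero m}} → fromℚ (+ 1 ℚ./ m) * fromℕ m ≈ 1#
    inv m = trans ([m/n]*n≈m 1 m) 1#-homo


-- Generating functions of generalized Euler polynomials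

module EulerProperties
  {c ℓ₁ ℓ₂} (K : FieldOverℚ c ℓ₁ ℓ₂) (d : ℕ) (odd-d : Odd d)
  (χ : ℤ → FieldOverℚ.Carrier K)
  (χ-periodic : ∀ a → FieldOverℚ._≈_ K (χ (+ (d ℕ.+ a))) (χ (+ a)))
  (χ-* : ∀ a b → FieldOverℚ._≈_ K (χ (+ (a ℕ.* b))) (FieldOverℚ._*_ K (χ (+ a)) (χ (+ b))))
  where
  open FieldOverℚ K
  open FieldProperties K
  open IsRingHomomorphism isRingHomomorphism
  open Exp semiring using (^-congˡ; ^-homo-*)
  open CommutativeExp commutativeSemiring using (^-distrib-*)
  open Sum semiring using (sum-cong-≋; *-distribˡ-sum; sum⁺-syntax)
  open RingProperties ring using (-‿distribˡ-*; -1*x≈-x)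
  open PowerSeries commutativeRing
  open SeriesRing commutativeRing
  open Euler K d χ
  private
    module S = CommutativeRing seriesRing
    module SExp = Exp S.semiring
    module SΣ = Sum S.semiring
    module SI = RingIdentities seriesRing
    module KI = RingIdentities commutativeRing
    module M = CommutativeMonoidSolver *-commutativeMonoid
    module SM = CommutativeMonoidSolver S.*-commutativeMonoid

  -- The exponential series

  exp-cong : ∀ {x y} → x ≈ y → exp x ≋ exp y
  exp-cong x≈y n = *-congˡ (^-congˡ n x≈y)

  exp-0# : exp 0# ≋ one
  exp-0# zero    = trans (*-identityʳ _) 1#-homo
  exp-0# (suc n) = trans (*-congˡ (zeroˡ _)) (zeroʳ _)

  exp-+ : ∀ x y → exp (x + y) ≋ exp x ⊛ exp y
  exp-+ x y n = begin
    r n * (x + y) ^ n                                    ≈⟨ *-congˡ (B.theorem n x y) ⟩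
    r n * ∑[ i ≤ n ] (B.binomialTerm x y n i)            ≈⟨ *-distribˡ-sum {suc n} (r n) (B.binomialTerm x y n) ⟩
    ∑[ i ≤ n ] (r n * B.binomialTerm x y n i)            ≈⟨ sum-cong-≋ {suc n} term ⟩
    (exp x ⊛ exp y) n                                    ∎
    where
    open SetoidReasoning setoid
    module B = Binomial commutativeSemiring
    r : ℕ → Carrier
    r n = fromℚ ((+ 1 ℚ./ n !) {{n ℕ.!≢0}})
    term : ∀ i → r n * B.binomialTerm x y n i ≈ exp x (toℕ i) * exp y (n ℕ.∸ toℕ i)
    term i = begin
      r n * B.binomialTerm x y n i                  ≈⟨ *-congˡ (n×x≈fromℕ[n]*x (n C k) (x ^ k * y ^ l)) ⟩
      r n * (fromℕ (n C k) * (x ^ k * y ^ l))       ≈⟨ *-assoc _ _ _ ⟨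
      r n * fromℕ (n C k) * (x ^ k * y ^ l)
        ≈⟨ *-congʳ ([1/a]*[1/b]≈k/c (k !) (l !) (n !) (n C k) {{k ℕ.!≢0}} {{l ℕ.!≢0}} {{n ℕ.!≢0}} (nCk*k![n∸k]!≡n! (toℕ≤pred[n] i))) ⟨
      r k * r l * (x ^ k * y ^ l)
        ≈⟨ M.solve 4 (λ a b x y → (a M.⊕ b) M.⊕ (x M.⊕ y) M.⊜ (a M.⊕ x) M.⊕ (b M.⊕ y)) refl (r k) (r l) (x ^ k) (y ^ l) ⟩
      r k * x ^ k * (r l * y ^ l)                   ∎
      where
      k = toℕ i
      l = n ℕ.∸ toℕ i

  dilate-exp : ∀ k x → dilate k (exp x) ≋ exp (k * x)
  dilate-exp k x n = begin
    -- The scalar 1 / n! varies with n, so `dilate-·` is applied at this one degree, to the series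
    -- of powers of `x`.
    k ^ n * (_ * x ^ n)     ≈⟨ dilate-· k _ (x ^_) n ⟩
    _ * (k ^ n * x ^ n)     ≈⟨ *-congˡ (^-distrib-* k x n) ⟨
    _ * (k * x) ^ n         ∎
    where open SetoidReasoning setoid

  exp-fromℕ-* : ∀ m k → exp (fromℕ (m ℕ.* k)) ≋ exp (fromℕ k) SExp.^ m
  exp-fromℕ-* zero    k = S.trans (exp-cong 0#-homo) exp-0#
  exp-fromℕ-* (suc m) k = begin
    exp (fromℕ (k ℕ.+ m ℕ.* k))                ≈⟨ exp-cong (fromℕ-+ k (m ℕ.* k)) ⟩
    exp (fromℕ k + fromℕ (m ℕ.* k))            ≈⟨ exp-+ _ _ ⟩
    exp (fromℕ k) ⊛ exp (fromℕ (m ℕ.* k))      ≈⟨ ⊛-congˡ (exp (fromℕ k)) (exp-fromℕ-* m k) ⟩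
    exp (fromℕ k) ⊛ exp (fromℕ k) SExp.^ m     ∎
    where open SetoidReasoning S.setoid

  -- Single character sums as geometric sums

  coefficient : ℕ → Carrier
  coefficient a = sign a * χ (+ a)

  -- The exponent is a product of natural numbers, so that rearranging weights is an equation in ℕ.
  -- `twistedSum k d` below is C(kt).
  twisted : ℕ → ℕ → Series
  twisted k a = coefficient a · exp (fromℕ (k ℕ.* a))

  twistedSum : ℕ → ℕ → Series
  twistedSum k m = SΣ.sum {m} (twisted k ∘ toℕ)

  expPlusOne : ℕ → Series
  expPlusOne k = exp (fromℕ (k ℕ.* d)) ⊕ one

  -- Obtained by dilation rather than by a fresh inversion, since this is the factor that dilating a
  -- generating function produces.
  inverseDenominator : ℕ → Series
  inverseDenominator k = dilate (fromℕ k) (inverse denominator (fromℚ ½) denominator₀)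

  expPlusOne-inverse : ∀ k → expPlusOne k ⊛ inverseDenominator k ≋ one
  expPlusOne-inverse k = begin
    expPlusOne k ⊛ inverseDenominator k
      ≈⟨ ⊛-congʳ (inverseDenominator k) (λ n → sym (dilated n)) ⟩
    dilate (fromℕ k) denominator ⊛ inverseDenominator k
      ≈⟨ dilate-⊛ (fromℕ k) denominator (inverse denominator (fromℚ ½) denominator₀) ⟨
    dilate (fromℕ k) (denominator ⊛ inverse denominator (fromℚ ½) denominator₀)
      ≈⟨ dilate-cong (fromℕ k) (⊛-inverse denominator (fromℚ ½) denominator₀) ⟩
    dilate (fromℕ k) one
      ≈⟨ dilate-one (fromℕ k) ⟩
    one
      ∎
    where
    open SetoidReasoning S.setoid
    dilated : dilate (fromℕ k) denominator ≋ expPlusOne k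
    dilated n = trans (dilate-⊕ (fromℕ k) (exp (fromℕ d)) one n)
      (+-cong (trans (dilate-exp (fromℕ k) (fromℕ d) n) (exp-cong (sym (fromℕ-* k d)) n))
              (dilate-one (fromℕ k) n))

  -- χ has period d, while the sign flips because d is odd; hence the ratio of the geometric sum is
  -- - e^{kdt}.
  coefficient-d+ : ∀ a → coefficient (d ℕ.+ a) ≈ - coefficient a
  coefficient-d+ a = begin
    sign (d ℕ.+ a) * χ (+ (d ℕ.+ a))     ≈⟨ *-cong (^-homo-* (- 1#) d a) (χ-periodic a) ⟩
    sign d * sign a * χ (+ a)            ≈⟨ *-congʳ (*-congʳ sign-d) ⟩
    - 1# * sign a * χ (+ a)              ≈⟨ *-assoc _ _ _ ⟩
    - 1# * (sign a * χ (+ a))            ≈⟨ -1*x≈-x _ ⟩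
    - (sign a * χ (+ a))                 ∎
    where
    open SetoidReasoning setoid
    1^n≈1 : ∀ n → 1# ^ n ≈ 1#
    1^n≈1 zero    = refl
    1^n≈1 (suc n) = trans (*-identityˡ _) (1^n≈1 n)
    sign-d : sign d ≈ - 1#
    sign-d = trans (KI.[-x]^odd≈-x^odd 1# d odd-d) (-‿cong (1^n≈1 d))

  twisted-d+ : ∀ k a → twisted k (d ℕ.+ a) ≋ (S.- exp (fromℕ (k ℕ.* d))) ⊛ twisted k a
  twisted-d+ k a n = begin
    coefficient (d ℕ.+ a) * exp (fromℕ (k ℕ.* (d ℕ.+ a))) n
      ≈⟨ *-cong (coefficient-d+ a) (exp-split n) ⟩
    - coefficient a * (e ⊛ f) n        ≈⟨ -‿distribˡ-* _ _ ⟨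
    - (coefficient a * (e ⊛ f) n)      ≈⟨ -‿cong (*-congˡ (⊛-comm e f n)) ⟩
    - (coefficient a * (f ⊛ e) n)      ≈⟨ -‿cong (⊛-·ˡ (coefficient a) f e n) ⟨
    - ((coefficient a · f) ⊛ e) n      ≈⟨ -‿cong (⊛-comm (coefficient a · f) e n) ⟩
    - (e ⊛ (coefficient a · f)) n      ≈⟨ SR.-‿distribˡ-* e (coefficient a · f) n ⟩
    ((S.- e) ⊛ (coefficient a · f)) n  ∎
    where
    open SetoidReasoning setoid
    module SR = RingProperties S.ring
    e = exp (fromℕ (k ℕ.* d))
    f = exp (fromℕ (k ℕ.* a))
    exp-split : exp (fromℕ (k ℕ.* (d ℕ.+ a))) ≋ e ⊛ f
    exp-split n = trans (exp-cong (trans (fromℕ-≡ (ℕ.*-distribˡ-+ k d a)) (fromℕ-+ (k ℕ.* d) (k ℕ.* a))) n) (exp-+ _ _ n)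

  twistedSum-d+ : ∀ k m → twistedSum k (d ℕ.+ m) ≋
                          twistedSum k d ⊕ (S.- exp (fromℕ (k ℕ.* d))) ⊛ twistedSum k m
  twistedSum-d+ k m = begin
    twistedSum k (d ℕ.+ m)
      ≈⟨ SI.sum-splitAt d m (twisted k) ⟩
    twistedSum k d ⊕ SΣ.sum {m} (λ a → twisted k (d ℕ.+ toℕ a))
      ≈⟨ S.+-congˡ {twistedSum k d} (SΣ.sum-cong-≋ {m} (λ a → twisted-d+ k (toℕ a))) ⟩
    twistedSum k d ⊕ SΣ.sum {m} (λ a → (S.- e) ⊛ twisted k (toℕ a))
      ≈⟨ S.+-congˡ {twistedSum k d} (SΣ.*-distribˡ-sum {m} (S.- e) (twisted k ∘ toℕ)) ⟨
    twistedSum k d ⊕ (S.- e) ⊛ twistedSum k m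
      ∎
    where
    open SetoidReasoning S.setoid
    e = exp (fromℕ (k ℕ.* d))

  -- This is Q(k).
  quotient : ℕ → Series
  quotient k = inverseDenominator k ⊛ twistedSum k d

  twistedSum-odd : ∀ k m → Odd m → twistedSum k (m ℕ.* d) ≋ quotient k ⊛ expPlusOne (m ℕ.* k)
  twistedSum-odd k m odd = begin
    twistedSum k (m ℕ.* d)
      -- `suc m ℕ.* d` unfolds to `d ℕ.+ m ℕ.* d`, so `twistedSum-d+` is literally the recurrence
      -- required of `B`, and the sum over no blocks is zero by computation.
      ≈⟨ SI.alternatingSum-odd e (twistedSum k d) (λ m → twistedSum k (m ℕ.* d)) (λ _ → refl)
           (λ m → twistedSum-d+ k (m ℕ.* d)) {inverseDenominator k} (expPlusOne-inverse k) m odd ⟩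
    quotient k ⊛ (e SExp.^ m ⊕ one)
      ≈⟨ ⊛-congˡ (quotient k) (λ n → +-congʳ (exp-fromℕ-* m (k ℕ.* d) n)) ⟨
    quotient k ⊛ (exp (fromℕ (m ℕ.* (k ℕ.* d))) ⊕ one)
      ≈⟨ ⊛-congˡ (quotient k) (λ n → +-congʳ (exp-cong (fromℕ-≡ (ℕ.*-assoc m k d)) n)) ⟨
    quotient k ⊛ expPlusOne (m ℕ.* k)
      ∎
    where
    open SetoidReasoning S.setoid
    e = exp (fromℕ (k ℕ.* d))

  dilate-characterSum : ∀ k → dilate (fromℕ k) characterSum ≋ twistedSum k d
  dilate-characterSum k n = begin
    fromℕ k ^ n * ∑[ a < d ] (coefficient (toℕ a) * exp (fromℕ (toℕ a)) n)
      ≈⟨ *-distribˡ-sum {d} (fromℕ k ^ n) (λ a → coefficient (toℕ a) * exp (fromℕ (toℕ a)) n) ⟩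
    ∑[ a < d ] (fromℕ k ^ n * (coefficient (toℕ a) * exp (fromℕ (toℕ a)) n))
      ≈⟨ sum-cong-≋ {d} (λ a → term (toℕ a)) ⟩
    ∑[ a < d ] (twisted k (toℕ a) n)
      ≈⟨ sum-coefficient {d} (twisted k ∘ toℕ) n ⟨
    twistedSum k d n
      ∎
    where
    open SetoidReasoning setoid
    term : ∀ a → fromℕ k ^ n * (coefficient a * exp (fromℕ a) n) ≈ twisted k a n
    term a = trans (dilate-· (fromℕ k) (coefficient a) (exp (fromℕ a)) n)
      (*-congˡ (trans (dilate-exp (fromℕ k) (fromℕ a) n) (exp-cong (sym (fromℕ-* k a)) n)))

  dilate-generatingFunction : ∀ k x →
    dilate (fromℕ k) (generatingFunction x) ≋ (fromℕ 2 · exp (fromℕ k * x)) ⊛ quotient k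
  dilate-generatingFunction k x = begin
    dilate κ (fromℕ 2 · exp x ⊛ I ⊛ characterSum)
      ≈⟨ dilate-⊛ κ (fromℕ 2 · exp x ⊛ I) characterSum ⟩
    dilate κ (fromℕ 2 · exp x ⊛ I) ⊛ dilate κ characterSum
      ≈⟨ ⊛-cong {g = dilate κ characterSum} (dilate-⊛ κ (fromℕ 2 · exp x) I) (dilate-characterSum k) ⟩
    dilate κ (fromℕ 2 · exp x) ⊛ inverseDenominator k ⊛ twistedSum k d
      ≈⟨ ⊛-assoc (dilate κ (fromℕ 2 · exp x)) (inverseDenominator k) (twistedSum k d) ⟩
    dilate κ (fromℕ 2 · exp x) ⊛ quotient k
      ≈⟨ ⊛-congʳ (quotient k) (λ n → trans (dilate-· κ (fromℕ 2) (exp x) n) (*-congˡ (dilate-exp κ x n))) ⟩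
    (fromℕ 2 · exp (κ * x)) ⊛ quotient k
      ∎
    where
    open SetoidReasoning S.setoid
    κ = fromℕ k
    I = inverse denominator (fromℚ ½) denominator₀

  -- The double sum as a coefficient of a product

  module _ (u v w : ℕ) .{{_ : NonZero u}} .{{_ : NonZero v}} (y : Carrier) where

    argument : ℕ → ℕ → Carrier
    argument a b = fromℕ w * y + ratio w u * fromℕ a + ratio w v * fromℕ b

    -- Collects what does not depend on the summation indices.
    prefactor : Series
    prefactor = (fromℕ 2 · exp (fromℕ (u ℕ.* v ℕ.* w) * y)) ⊛ quotient (u ℕ.* v)

    -- Multiplying by uv cancels the denominators u and v, leaving the levels vw and uw as integers.
    scaled-argument : ∀ a b → fromℕ (u ℕ.* v) * argument a b ≈
      fromℕ (u ℕ.* v ℕ.* w) * y + fromℕ (v ℕ.* w ℕ.* a) + fromℕ (u ℕ.* w ℕ.* b)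
    scaled-argument a b = begin
      U*V * (W * y + ratio w u * A + ratio w v * B)
        ≈⟨ trans (distribˡ _ _ _) (+-congʳ (distribˡ _ _ _)) ⟩
      U*V * (W * y) + U*V * (ratio w u * A) + U*V * (ratio w v * B)
        ≈⟨ +-cong (+-cong first second) third ⟩
      fromℕ (u ℕ.* v ℕ.* w) * y + fromℕ (v ℕ.* w ℕ.* a) + fromℕ (u ℕ.* w ℕ.* b)
        ∎
      where
      open SetoidReasoning setoid
      U*V = fromℕ (u ℕ.* v)
      W = fromℕ w
      A = fromℕ a
      B = fromℕ b
      fromℕ-*₃ : ∀ a b c → fromℕ (a ℕ.* b ℕ.* c) ≈ fromℕ a * fromℕ b * fromℕ c
      fromℕ-*₃ a b c = trans (fromℕ-* (a ℕ.* b) c) (*-congʳ (fromℕ-* a b))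
      first : U*V * (W * y) ≈ fromℕ (u ℕ.* v ℕ.* w) * y
      first = trans (sym (*-assoc _ _ _)) (*-congʳ (sym (fromℕ-* (u ℕ.* v) w)))
      second : U*V * (ratio w u * A) ≈ fromℕ (v ℕ.* w ℕ.* a)
      second = begin
        U*V * (ratio w u * A)                  ≈⟨ *-congʳ (fromℕ-* u v) ⟩
        fromℕ u * fromℕ v * (ratio w u * A)
          ≈⟨ M.solve 4 (λ u v r a → (u M.⊕ v) M.⊕ (r M.⊕ a) M.⊜ (v M.⊕ (r M.⊕ u)) M.⊕ a) refl (fromℕ u) (fromℕ v) (ratio w u) A ⟩
        fromℕ v * (ratio w u * fromℕ u) * A    ≈⟨ *-congʳ (*-congˡ ([m/n]*n≈m w u)) ⟩
        fromℕ v * W * A                        ≈⟨ fromℕ-*₃ v w a ⟨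
        fromℕ (v ℕ.* w ℕ.* a)                  ∎
      third : U*V * (ratio w v * B) ≈ fromℕ (u ℕ.* w ℕ.* b)
      third = begin
        U*V * (ratio w v * B)                  ≈⟨ *-congʳ (fromℕ-* u v) ⟩
        fromℕ u * fromℕ v * (ratio w v * B)
          ≈⟨ M.solve 4 (λ u v r b → (u M.⊕ v) M.⊕ (r M.⊕ b) M.⊜ (u M.⊕ (r M.⊕ v)) M.⊕ b) refl (fromℕ u) (fromℕ v) (ratio w v) B ⟩
        fromℕ u * (ratio w v * fromℕ v) * B    ≈⟨ *-congʳ (*-congˡ ([m/n]*n≈m w v)) ⟩
        fromℕ u * W * B                        ≈⟨ fromℕ-*₃ u w b ⟨
        fromℕ (u ℕ.* w ℕ.* b)                  ∎

    dilate-generatingFunction-argument : ∀ a b →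
      dilate (fromℕ (u ℕ.* v)) (generatingFunction (argument a b)) ≋
      prefactor ⊛ exp (fromℕ (v ℕ.* w ℕ.* a)) ⊛ exp (fromℕ (u ℕ.* w ℕ.* b))
    dilate-generatingFunction-argument a b = begin
      dilate (fromℕ (u ℕ.* v)) (generatingFunction (argument a b))
        ≈⟨ dilate-generatingFunction (u ℕ.* v) (argument a b) ⟩
      (fromℕ 2 · exp (fromℕ (u ℕ.* v) * argument a b)) ⊛ Q
        ≈⟨ ⊛-congʳ Q (λ n → *-congˡ {fromℕ 2} (exp-split n)) ⟩
      (fromℕ 2 · (eʸ ⊛ eᵃ ⊛ eᵇ)) ⊛ Q
        ≈⟨ ⊛-congʳ Q (λ n → sym (·-split n)) ⟩
      (fromℕ 2 · eʸ) ⊛ eᵃ ⊛ eᵇ ⊛ Q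
        ≈⟨ SM.solve 4 (λ x a b q → ((x SM.⊕ a) SM.⊕ b) SM.⊕ q SM.⊜ ((x SM.⊕ q) SM.⊕ a) SM.⊕ b) (λ _ → refl) (fromℕ 2 · eʸ) eᵃ eᵇ Q ⟩
      (fromℕ 2 · eʸ) ⊛ Q ⊛ eᵃ ⊛ eᵇ
        ∎
      where
      open SetoidReasoning S.setoid
      Q = quotient (u ℕ.* v)
      eʸ = exp (fromℕ (u ℕ.* v ℕ.* w) * y)
      eᵃ = exp (fromℕ (v ℕ.* w ℕ.* a))
      eᵇ = exp (fromℕ (u ℕ.* w ℕ.* b))
      exp-split : exp (fromℕ (u ℕ.* v) * argument a b) ≋ eʸ ⊛ eᵃ ⊛ eᵇ
      exp-split n = trans (exp-cong (scaled-argument a b) n)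
        (trans (exp-+ _ _ n) (⊛-congʳ eᵇ (exp-+ _ _) n))
      ·-split : (fromℕ 2 · eʸ) ⊛ eᵃ ⊛ eᵇ ≋ fromℕ 2 · (eʸ ⊛ eᵃ ⊛ eᵇ)
      ·-split n = trans (⊛-congʳ eᵇ (⊛-·ˡ (fromℕ 2) eʸ eᵃ) n) (⊛-·ˡ (fromℕ 2) (eʸ ⊛ eᵃ) eᵇ n)

    doubleSumSeries : Series
    doubleSumSeries =
      prefactor ⊛ twistedSum (v ℕ.* w) (u ℕ.* d) ⊛ twistedSum (u ℕ.* w) (v ℕ.* d)

    -- At degree n the factor (uv)^n is exactly a dilation by uv. Sign and character split into an
    -- a-part and a b-part, and each part is absorbed as a scalar into its own exponential.
    doubleSum-term : ∀ n a b →
      fromℕ ((u ℕ.* v) ℕ.^ n) *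
        (sign (a ℕ.+ b) * χ (+ (a ℕ.* b)) * (fromℕ (n !) * generatingFunction (argument a b) n)) ≈
      fromℕ (n !) * (prefactor ⊛ twisted (v ℕ.* w) a ⊛ twisted (u ℕ.* w) b) n
    doubleSum-term n a b = begin
      fromℕ ((u ℕ.* v) ℕ.^ n) * (sign (a ℕ.+ b) * χ (+ (a ℕ.* b)) * (N * g))
        ≈⟨ *-cong (fromℕ-^ (u ℕ.* v) n) (*-congʳ (*-cong (^-homo-* (- 1#) a b) (χ-* a b))) ⟩
      κⁿ * (sign a * sign b * (χ (+ a) * χ (+ b)) * (N * g))
        ≈⟨ M.solve 7 (λ k s t x y n g → k M.⊕ (((s M.⊕ t) M.⊕ (x M.⊕ y)) M.⊕ (n M.⊕ g))
                                  M.⊜ n M.⊕ ((t M.⊕ y) M.⊕ ((s M.⊕ x) M.⊕ (k M.⊕ g)))) refl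
             κⁿ (sign a) (sign b) (χ (+ a)) (χ (+ b)) N g ⟩
      N * (coefficient b * (coefficient a * (κⁿ * g)))
        ≈⟨ *-congˡ (*-congˡ (*-congˡ (dilate-generatingFunction-argument a b n))) ⟩
      N * (coefficient b * (coefficient a * (prefactor ⊛ eᵃ ⊛ eᵇ) n))
        ≈⟨ *-congˡ (*-congˡ (trans (⊛-congʳ eᵇ (⊛-·ʳ (coefficient a) prefactor eᵃ) n)
                                   (⊛-·ˡ (coefficient a) (prefactor ⊛ eᵃ) eᵇ n))) ⟨
      N * (coefficient b * (prefactor ⊛ (coefficient a · eᵃ) ⊛ eᵇ) n)
        ≈⟨ *-congˡ (⊛-·ʳ (coefficient b) (prefactor ⊛ (coefficient a · eᵃ)) eᵇ n) ⟨
      N * (prefactor ⊛ (coefficient a · eᵃ) ⊛ (coefficient b · eᵇ)) n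
        ∎
      where
      open SetoidReasoning setoid
      N = fromℕ (n !)
      g = generatingFunction (argument a b) n
      κⁿ = fromℕ (u ℕ.* v) ^ n
      eᵃ = exp (fromℕ (v ℕ.* w ℕ.* a))
      eᵇ = exp (fromℕ (u ℕ.* w ℕ.* b))

  doubleSum-coefficient : ∀ u v w .{{_ : NonZero u}} .{{_ : NonZero v}} .{{_ : NonZero w}} n y →
    doubleSum u v w n y ≈ fromℕ (n !) * doubleSumSeries u v w y n
  doubleSum-coefficient u v w n y = begin
    doubleSum u v w n y
      ≈⟨ KI.∑∑-*ˡ {u ℕ.* d} {v ℕ.* d} (fromℕ ((u ℕ.* v) ℕ.^ n)) (λ a b →
           sign (toℕ a ℕ.+ toℕ b) * χ (+ (toℕ a ℕ.* toℕ b)) * E n (argument u v w y (toℕ a) (toℕ b))) ⟩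
    ∑[ a < u ℕ.* d ] ∑[ b < v ℕ.* d ] (fromℕ ((u ℕ.* v) ℕ.^ n) *
      (sign (toℕ a ℕ.+ toℕ b) * χ (+ (toℕ a ℕ.* toℕ b)) * E n (argument u v w y (toℕ a) (toℕ b))))
      ≈⟨ sum-cong-≋ {u ℕ.* d} (λ a → sum-cong-≋ {v ℕ.* d} (λ b → doubleSum-term u v w y n (toℕ a) (toℕ b))) ⟩
    ∑[ a < u ℕ.* d ] ∑[ b < v ℕ.* d ] (fromℕ (n !) * F a b n)
      ≈⟨ KI.∑∑-*ˡ {u ℕ.* d} {v ℕ.* d} (fromℕ (n !)) (λ a b → F a b n) ⟨
    fromℕ (n !) * (∑[ a < u ℕ.* d ] ∑[ b < v ℕ.* d ] F a b n)
      ≈⟨ *-congˡ (trans (sum-coefficient {u ℕ.* d} (λ a → SΣ.sum {v ℕ.* d} (F a)) n)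
                        (sum-cong-≋ {u ℕ.* d} (λ a → sum-coefficient {v ℕ.* d} (F a) n))) ⟨
    fromℕ (n !) * SΣ.sum {u ℕ.* d} (λ a → SΣ.sum {v ℕ.* d} (F a)) n
      -- Only at the level of series does the double sum factor; a single coefficient would give a
      -- convolution.
      ≈⟨ *-congˡ (SI.∑∑-product {u ℕ.* d} {v ℕ.* d} P (twisted (v ℕ.* w) ∘ toℕ) (twisted (u ℕ.* w) ∘ toℕ) n) ⟩
    fromℕ (n !) * doubleSumSeries u v w y n
      ∎
    where
    open SetoidReasoning setoid
    P = prefactor u v w y
    F : Fin (u ℕ.* d) → Fin (v ℕ.* d) → Series
    F a b = P ⊛ twisted (v ℕ.* w) (toℕ a) ⊛ twisted (u ℕ.* w) (toℕ b)

  -- Symmetry in the weights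

  -- `m` will be uvw, the only way the weights enter. One `expPlusOne m` comes from each of the two
  -- single sums.
  symmetricFactor : Carrier → ℕ → Series
  symmetricFactor y m = (fromℕ 2 · exp (fromℕ m * y)) ⊛ expPlusOne m ⊛ expPlusOne m

  -- `twistedSum-odd` yields the levels u(vw) and v(uw), which agree. The last quotient is written
  -- with `w ℕ.* u`, so that rotating the weights permutes the three quotients as they stand.
  doubleSumSeries-symmetric : ∀ u v w .{{_ : NonZero u}} .{{_ : NonZero v}} y → Odd u → Odd v →
    doubleSumSeries u v w y ≋
    symmetricFactor y (u ℕ.* v ℕ.* w) ⊛ (quotient (u ℕ.* v) ⊛ quotient (v ℕ.* w) ⊛ quotient (w ℕ.* u))
  doubleSumSeries-symmetric u v w y odd-u odd-v = begin
    X ⊛ q₁ ⊛ twistedSum (v ℕ.* w) (u ℕ.* d) ⊛ twistedSum (u ℕ.* w) (v ℕ.* d)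
      ≈⟨ ⊛-cong {g = twistedSum (u ℕ.* w) (v ℕ.* d)}
           (⊛-congˡ (X ⊛ q₁) {twistedSum (v ℕ.* w) (u ℕ.* d)} {q₂ ⊛ D} vw-u) uw-v ⟩
    X ⊛ q₁ ⊛ (q₂ ⊛ D) ⊛ (q₃ ⊛ D)
      ≈⟨ SM.solve 5 (λ x a b c d → ((x SM.⊕ a) SM.⊕ (b SM.⊕ d)) SM.⊕ (c SM.⊕ d)
                             SM.⊜ ((x SM.⊕ d) SM.⊕ d) SM.⊕ ((a SM.⊕ b) SM.⊕ c)) (λ _ → refl) X q₁ q₂ q₃ D ⟩
    X ⊛ D ⊛ D ⊛ (q₁ ⊛ q₂ ⊛ q₃)
      ∎
    where
    open SetoidReasoning S.setoid
    X = fromℕ 2 · exp (fromℕ (u ℕ.* v ℕ.* w) * y)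
    q₁ = quotient (u ℕ.* v)
    q₂ = quotient (v ℕ.* w)
    q₃ = quotient (w ℕ.* u)
    D = expPlusOne (u ℕ.* v ℕ.* w)
    open +-*-Solver using (solve; _:*_; _:=_)
    vw-u : twistedSum (v ℕ.* w) (u ℕ.* d) ≋ q₂ ⊛ D
    vw-u = ≡.subst (λ m → twistedSum (v ℕ.* w) (u ℕ.* d) ≋ q₂ ⊛ expPlusOne m)
      (≡.sym (ℕ.*-assoc u v w)) (twistedSum-odd (v ℕ.* w) u odd-u)
    uw-v : twistedSum (u ℕ.* w) (v ℕ.* d) ≋ q₃ ⊛ D
    uw-v = ≡.subst₂ (λ k m → twistedSum (u ℕ.* w) (v ℕ.* d) ≋ quotient k ⊛ expPlusOne m)
      (ℕ.*-comm u w)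
      (solve 3 (λ u v w → v :* (u :* w) := u :* v :* w) ≡.refl u v w)
      (twistedSum-odd (u ℕ.* w) v odd-v)

  -- One rotation is enough: the second equality of the theorem is the same statement for the
  -- rotated weights.
  doubleSum-cyclic : ∀ u v w .{{_ : NonZero u}} .{{_ : NonZero v}} .{{_ : NonZero w}} →
    Odd u → Odd v → Odd w → ∀ n y → doubleSum u v w n y ≈ doubleSum v w u n y
  doubleSum-cyclic u v w odd-u odd-v odd-w n y = begin
    doubleSum u v w n y
      ≈⟨ doubleSum-coefficient u v w n y ⟩
    fromℕ (n !) * doubleSumSeries u v w y n
      ≈⟨ *-congˡ (doubleSumSeries-symmetric u v w y odd-u odd-v n) ⟩
    fromℕ (n !) * (symmetricFactor y (u ℕ.* v ℕ.* w) ⊛ (q₁ ⊛ q₂ ⊛ q₃)) n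
      ≈⟨ *-congˡ (⊛-congˡ (symmetricFactor y (u ℕ.* v ℕ.* w)) rotate n) ⟩
    fromℕ (n !) * (symmetricFactor y (u ℕ.* v ℕ.* w) ⊛ (q₂ ⊛ q₃ ⊛ q₁)) n
      ≡⟨ ≡.cong (λ m → fromℕ (n !) * (symmetricFactor y m ⊛ (q₂ ⊛ q₃ ⊛ q₁)) n)
           (≡.trans (ℕ.*-assoc u v w) (ℕ.*-comm u (v ℕ.* w))) ⟩
    fromℕ (n !) * (symmetricFactor y (v ℕ.* w ℕ.* u) ⊛ (q₂ ⊛ q₃ ⊛ q₁)) n
      ≈⟨ *-congˡ (doubleSumSeries-symmetric v w u y odd-v odd-w n) ⟨
    fromℕ (n !) * doubleSumSeries v w u y n
      ≈⟨ doubleSum-coefficient v w u n y ⟨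
    doubleSum v w u n y
      ∎
    where
    open SetoidReasoning setoid
    q₁ = quotient (u ℕ.* v)
    q₂ = quotient (v ℕ.* w)
    q₃ = quotient (w ℕ.* u)
    rotate : q₁ ⊛ q₂ ⊛ q₃ ≋ q₂ ⊛ q₃ ⊛ q₁
    rotate = S.trans {q₁ ⊛ q₂ ⊛ q₃} {q₁ ⊛ (q₂ ⊛ q₃)} {q₂ ⊛ q₃ ⊛ q₁} (⊛-assoc q₁ q₂ q₃) (⊛-comm q₁ (q₂ ⊛ q₃))

theorem4p6 :
  ∀ {c ℓ₁ ℓ₂ c′ ℓ₁′ ℓ₂′}
    (p : ℕ) → Prime p → Odd p →
    (ℚ̄ : AlgebraicClosureOfℚ c ℓ₁ ℓ₂)
    (ℂₚ : CompletedAlgebraicClosureOfℚₚ p c′ ℓ₁′ ℓ₂′) →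
    let module ℚ̄ = AlgebraicClosureOfℚ ℚ̄
        module ℂₚ = CompletedAlgebraicClosureOfℚₚ ℂₚ
    in
    (ι : ℚ̄.Carrier → ℂₚ.Carrier) → IsRingMonomorphism ℚ̄.rawRing ℂₚ.rawRing ι →
    (d : ℕ) .{{_ : NonZero d}} → Odd d →
    (ψ : DirichletCharacter ℚ̄.commutativeRing d) → DirichletCharacter.Primitive ψ →
    let open ℂₚ
        χ : ℤ → ℂₚ.Carrier
        χ a = ι (DirichletCharacter.χ ψ a)
        open Euler ℂₚ.fieldOverℚ d χ using (doubleSum)
    in
    (w₁ w₂ w₃ : ℕ) .{{_ : NonZero w₁}} .{{_ : NonZero w₂}} .{{_ : NonZero w₃}} →
    Odd w₁ → Odd w₂ → Odd w₃ →
    (n : ℕ) (y₁ : ℂₚ.Carrier) → y₁ ∈ℤₚ →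
    doubleSum w₁ w₂ w₃ n y₁ ≈ doubleSum w₂ w₃ w₁ n y₁
    × doubleSum w₂ w₃ w₁ n y₁ ≈ doubleSum w₃ w₁ w₂ n y₁
theorem4p6 p _ _ ℚ̄ ℂₚ ι ι-mono d odd-d ψ _ w₁ w₂ w₃ odd₁ odd₂ odd₃ n y _ =
  doubleSum-cyclic w₁ w₂ w₃ odd₁ odd₂ odd₃ n y , doubleSum-cyclic w₂ w₃ w₁ odd₂ odd₃ odd₁ n y
  where
  module ℂₚ = CompletedAlgebraicClosureOfℚₚ ℂₚ
  open IsRingMonomorphism ι-mono using (⟦⟧-cong; *-homo)
  open DirichletCharacter ψ

  d∣[d+a]-a : ∀ a → (+ d) ℤDiv.∣ (+ (d ℕ.+ a) ℤ.- + a)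
  -- Divisibility in ℤ is divisibility of absolute values in ℕ, so it suffices that the difference
  -- has absolute value d.
  d∣[d+a]-a a = ℕDiv.∣-reflexive (≡.cong ℤ.∣_∣ (≡.sym (≡.trans
    (ℤ.+-assoc (+ d) (+ a) (ℤ.- + a))
    (≡.trans (≡.cong (ℤ._+_ (+ d)) (ℤ.+-inverseʳ (+ a))) (ℤ.+-identityʳ (+ d))))))

  open EulerProperties ℂₚ.fieldOverℚ d odd-d (ι ∘ χ)
    (λ a → ⟦⟧-cong (periodic _ _ (d∣[d+a]-a a)))
    (λ a b → ℂₚ.trans (ℂₚ.reflexive (≡.cong (ι ∘ χ) (ℤ.pos-* a b)))
                      (ℂₚ.trans (⟦⟧-cong (χ-* (+ a) (+ b))) (*-homo _ _)))
    using (doubleSum-cyclic)
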